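{- Let $n\ge 4$ be an integer with $n\equiv 0$ or $1 \pmod 4$. Let $lsc(n)=|\mathcal{S}_n|$ be the number of labelled self-complementary graphs of order $n$, and let $\mathcal{L}(\mathcal{S}_n)$ be the set of all exponents $L$ such that $x^L$ occurs with nonzero coefficient in the expansion of the polynomial $U^{(n)}(x)$. Then $$lsc(n)=|\mathcal{L}(\mathcal{S}_n)|.$$
   Context: Let $V=\{1,\dots,n\}$ and let $\binom{V}{2}$ be the set of 2-element subsets of $V$; write $ij$ for $\{i,j\}$ with $i<j$. A labelled graph of order $n$ is a pair $G=(V,E)$ with $E\subseteq\binom{V}{2}$; $\overline{G}=(V,\binom{V}{2}\setminus E)$ is its complement. Let $A$ be the symmetric group on $V$. For $\alpha\in A$, $\alpha G$ is the graph on $V$ with edge-set $\{\{\alpha i,\alpha j\}: ij\in E\}$, and $\alpha'$ is the permutation of $\binom{V}{2}$ given by $\alpha'\{i,j\}=\{\alpha i,\alpha j\}$. $Z(\alpha')$ denotes the set of all cycles (including cycles of length 1) in the disjoint cycle decomposition of $\alpha'$. $G$ is self-complementary if $\alpha G=\overline{G}$ for some $\alpha\in A$; $\mathcal{S}_n$ is the set of all self-complementary labelled graphs on $V$. Put $A_S=\{\alpha\in A:\exists G\in\mathcal{S}_n,\ \alpha G=\overline{G}\}$. Let $\lambda=\binom{n}{2}$, and for $ij\in\binom{V}{2}$ ($i<j$) let $p_{ij}=\frac{(2n-i)(i-1)}{2}+(j-i)$ and $w(ij)=2^{\lambda-p_{ij}}$; $w$ is a bijection from $\binom{V}{2}$ onto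 $\{2^0,2^1,\dots,2^{\lambda-1}\}$. For $\alpha\in A_S$, every cycle $z\in Z(\alpha')$ has even length. Write $z=(i_1j_1,i_2j_2,\dots,i_kj_k)$, starting with the element of $z$ at which $w$ is largest, and let $P_1(z)=\{i_1j_1,i_3j_3,\dots,i_{k-1}j_{k-1}\}$ and $P_2(z)=\{i_2j_2,i_4j_4,\dots,i_kj_k\}$. Put $W_1(z)=\sum_{ij\in P_1(z)}w(ij)$, $W_2(z)=\sum_{ij\in P_2(z)}w(ij)$, and define the polynomials $$U_\alpha^{(n)}(x)=\prod_{z\in Z(\alpha')}\bigl(x^{W_1(z)}+x^{W_2(z)}\bigr),\qquad U^{(n)}(x)=\sum_{\alpha\in A_S}U_\alpha^{(n)}(x).$$ -}

module Defs where

open import Data.Bool.Properties using () renaming (_≟_ to _≟ᵇ_)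
open import Data.Fin using (Fin; zero; suc; toℕ; fromℕ<; punchIn; _<_)
open import Data.Fin.Permutation
  using (Permutation′; _⟨$⟩ʳ_; _≈_; insert; remove; insert-remove)
  renaming (id to idₚ)
open import Data.Fin.Properties
  using (any?; *↔×; 2↔Bool; <-cmp; <⇒≢; toℕ<n; toℕ-fromℕ<; fromℕ<-toℕ)
  renaming (_≟_ to _≟ᶠ_; _<?_ to _<ᶠ?_)
open import Data.Fin.Subset using (Subset; _∈_; ∁)
open import Data.Fin.Subset.Properties using (_∈?_; anySubset?)
open import Data.Irrelevant using ([_])
open import Data.List as List
  using (List; []; _∷_; _++_; length; map; filter; foldr; allFin; iterate;
         takeWhile; replicate; cartesianProductWith)
open import Data.List.Membership.Propositional.Properties using (∈-allFin)
open import Data.List.Relation.Unary.All as All using ()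
open import Data.List.Relation.Unary.Any as Any using (Any; here)
open import Data.List.Relation.Unary.Any.Properties using (cartesianProductWith⁺)
open import Data.Nat as ℕ using (ℕ; zero; suc; _+_; _*_; _∸_; _^_; _/_; _≤?_; s≤s; z≤n)
open import Data.Nat.Combinatorics using (_C_)
open import Data.Nat.ListAction using (sum)
open import Data.Product using (∃; _×_; _,_; proj₁; proj₂)
import Data.Product.Properties as Product
open import Data.Product.Function.NonDependent.Propositional using (_×-↔_)
open import Data.Refinement as Refinement using (Refinement-syntax; _,_)
open import Data.Vec using ([]; _∷_; tabulate)
import Data.Vec.Properties as Vec
open import Function using (_↔_; mk↔ₛ′; mk⇔; Inverse; Injection; _∘_)
open import Function.Construct.Composition using (_↔-∘_)
open import Function.Properties.Inverse using (↔⇒↣)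
open import Level using (0ℓ)
open import Relation.Binary using (DecidableEquality; tri<; tri≈; tri>)
open import Relation.Binary.PropositionalEquality
  using (_≡_; _≢_; refl; sym; trans; cong; cong₂; subst)
open import Relation.Nullary
  using (Dec; does; yes; no; ¬?; _×-dec_; map′; contradiction; contradiction-irr)
open import Relation.Nullary.Decidable using (does-⇔)
open import Relation.Unary using (Pred; Decidable)

private variable
  k n : ℕ
  A B : Set

record Finite (A : Set) : Set where
  field
    card : ℕ
    enum : Fin card ↔ A

  element : Fin card → A
  element = Inverse.to enum

  elements : List A
  elements = map element (allFin card)

open Finite

finite-↔ : A ↔ B → Finite A → Finite B
finite-↔ A↔B fin .card = fin .card
finite-↔ A↔B fin .enum = A↔B ↔-∘ fin .enum

finite-Fin : Finite (Fin n)
finite-Fin {n} .card = n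
finite-Fin .enum = mk↔ₛ′ (λ i → i) (λ i → i) (λ _ → refl) (λ _ → refl)

finite-× : Finite A → Finite B → Finite (A × B)
finite-× finA finB .card = finA .card * finB .card
finite-× finA finB .enum = (finA .enum ×-↔ finB .enum) ↔-∘ *↔×

finite-Subset : ∀ m → Finite (Subset m)
finite-Subset zero .card = 1
finite-Subset zero .enum = mk↔ₛ′ (λ _ → []) (λ _ → zero) (λ { [] → refl }) (λ { zero → refl })
finite-Subset (suc m) = finite-↔
  (mk↔ₛ′ (λ { (b , s) → b ∷ s }) (λ { (b ∷ s) → b , s }) (λ { (_ ∷ _) → refl }) (λ _ → refl))
  (finite-× (record { card = 2 ; enum = 2↔Bool }) (finite-Subset m))

refine-↔ : (A↔B : A ↔ B) {P : Pred B 0ℓ} →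
           [ a ∈ A ∣ P (Inverse.to A↔B a) ] ↔ [ b ∈ B ∣ P b ]
refine-↔ A↔B {P} = mk↔ₛ′
  (λ { (a , [ p ]) → to a , [ p ] })
  (λ { (b , [ p ]) → from b , [ subst P (sym (strictlyInverseˡ b)) p ] })
  (λ { (b , [ p ]) → Refinement.value-injective (strictlyInverseˡ b) })
  (λ { (a , [ p ]) → Refinement.value-injective (strictlyInverseʳ a) })
  where open Inverse A↔B

finite-refine-Fin : {P : Pred (Fin k) 0ℓ} → Decidable P → Finite [ i ∈ Fin k ∣ P i ]
finite-refine-Fin {zero} P? .card = 0
finite-refine-Fin {zero} P? .enum = mk↔ₛ′ (λ ()) (λ { (() , _) }) (λ { (() , _) }) (λ ())
finite-refine-Fin {suc k} {P} P? with finite-refine-Fin (P? ∘ suc) | P? zero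
... | fin | yes p₀ = record { card = suc (fin .card) ; enum = mk↔ₛ′ f g fg gf }
  where
  module E = Inverse (fin .enum)
  f : Fin (suc (fin .card)) → [ i ∈ Fin (suc k) ∣ P i ]
  f zero    = zero , [ p₀ ]
  f (suc j) = Refinement.map suc (λ p → p) (E.to j)
  g : [ i ∈ Fin (suc k) ∣ P i ] → Fin (suc (fin .card))
  g (zero  , _) = zero
  g (suc i , p) = suc (E.from (i , p))
  fg : ∀ x → f (g x) ≡ x
  fg (zero  , _) = refl
  fg (suc i , p) = cong (Refinement.map suc (λ p → p)) (E.strictlyInverseˡ (i , p))
  gf : ∀ j → g (f j) ≡ j
  gf zero    = refl
  gf (suc j) = cong suc (E.strictlyInverseʳ j)
... | fin | no ¬p₀ = record { card = fin .card ; enum = mk↔ₛ′ f g fg E.strictlyInverseʳ }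
  where
  module E = Inverse (fin .enum)
  f : Fin (fin .card) → [ i ∈ Fin (suc k) ∣ P i ]
  f j = Refinement.map suc (λ p → p) (E.to j)
  g : [ i ∈ Fin (suc k) ∣ P i ] → Fin (fin .card)
  g (zero  , [ p ]) = contradiction-irr p ¬p₀
  g (suc i , p) = E.from (i , p)
  fg : ∀ x → f (g x) ≡ x
  fg (zero  , [ p ]) = contradiction-irr p ¬p₀
  fg (suc i , p) = cong (Refinement.map suc (λ p → p)) (E.strictlyInverseˡ (i , p))

finite-refine : Finite A → {P : Pred A 0ℓ} → Decidable P → Finite [ a ∈ A ∣ P a ]
finite-refine fin P? =
  finite-↔ (refine-↔ (fin .enum)) (finite-refine-Fin (P? ∘ element fin))

-- V is Fin n; the pair ij (i < j) is the refined pair (i , j).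

Pair : ℕ → Set
Pair n = [ ij ∈ Fin n × Fin n ∣ proj₁ ij < proj₂ ij ]

finite-Pair : ∀ n → Finite (Pair n)
finite-Pair n =
  finite-refine (finite-× finite-Fin finite-Fin) (λ ij → proj₁ ij <ᶠ? proj₂ ij)

_≟ₚ_ : DecidableEquality (Pair n)
_≟ₚ_ = Refinement._≟_ (Product.≡-dec _≟ᶠ_ _≟ᶠ_)

-- The 2-element set {a , b}, in either order of a and b.
pair : (a b : Fin n) → .(a ≢ b) → Pair n
pair a b a≢b with <-cmp a b
... | tri< a<b _ _ = (a , b) , [ a<b ]
... | tri≈ _ a≡b _ = contradiction-irr a≢b (λ a≢b → a≢b a≡b)
... | tri> _ _ b<a = (b , a) , [ b<a ]

_′_ : Permutation′ n → Pair n → Pair n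
α ′ ((i , j) , [ i<j ]) =
  pair (α ⟨$⟩ʳ i) (α ⟨$⟩ʳ j) (<⇒≢ i<j ∘ Injection.injective (↔⇒↣ α))

pairAt : Fin (card (finite-Pair n)) → Pair n
pairAt {n} = element (finite-Pair n)

-- The pairs are numbered by the bijection pairAt, so that an edge set is a
-- Subset in the sense of the standard library.
record Graph (n : ℕ) : Set where
  constructor graph
  field E : Subset (card (finite-Pair n))

open Graph

_≟ᵍ_ : DecidableEquality (Graph n)
graph E₁ ≟ᵍ graph E₂ = map′ (cong graph) (cong E) (Vec.≡-dec _≟ᵇ_ E₁ E₂)

anyGraph? : {P : Pred (Graph n) 0ℓ} → Decidable P → Dec (∃ P)
anyGraph? P? = map′ (λ { (S , p) → graph S , p }) (λ { (graph S , p) → S , p })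
                    (anySubset? (P? ∘ graph))

complement : Graph n → Graph n
complement G .E = ∁ (E G)

InImage : Permutation′ n → Graph n → Pred (Fin (card (finite-Pair n))) 0ℓ
InImage α G k = ∃ λ l → l ∈ E G × α ′ pairAt l ≡ pairAt k

inImage? : ∀ (α : Permutation′ n) G → Decidable (InImage α G)
inImage? α G k = any? λ l → (l ∈? E G) ×-dec ((α ′ pairAt l) ≟ₚ pairAt k)

_·_ : Permutation′ n → Graph n → Graph n
(α · G) .E = tabulate (does ∘ inImage? α G)

SelfComplementary : Pred (Graph n) 0ℓ
SelfComplementary {n} G = ∃ λ (α : Permutation′ n) → α · G ≡ complement G

𝒮 : ℕ → Set
𝒮 n = [ G ∈ Graph n ∣ SelfComplementary G ]

A-𝒮 : Pred (Permutation′ n) 0ℓ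
A-𝒮 {n} α = ∃ λ (G : Graph n) → SelfComplementary G × α · G ≡ complement G

-- Every permutation of Fin n exactly once, up to pointwise equality _≈_:
-- insert zero i π sends zero to i and acts as π on the remaining elements.
permutations : ∀ n → List (Permutation′ n)
permutations zero    = idₚ ∷ []
permutations (suc n) = cartesianProductWith (insert zero) (allFin (suc n)) (permutations n)

insert-cong : ∀ (i j : Fin (suc n)) {π ρ : Permutation′ n} → π ≈ ρ → insert i j π ≈ insert i j ρ
insert-cong i j π≈ρ k with i ≟ᶠ k
... | yes _ = refl
... | no  _ = cong (punchIn j) (π≈ρ _)

permutations-complete : (π : Permutation′ n) → Any (π ≈_) (permutations n)
permutations-complete {zero}  π = here λ ()
permutations-complete {suc n} π =
  cartesianProductWith⁺ (insert zero)
    (λ { {y = ρ} refl rem≈ρ k → trans (sym (insert-remove zero π k))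
                          (insert-cong zero (π ⟨$⟩ʳ zero) {remove zero π} {ρ} rem≈ρ k) })
    (∈-allFin (π ⟨$⟩ʳ zero))
    (permutations-complete (remove zero π))

pair-cong : {a b c d : Fin n} .(a≢b : a ≢ b) .(c≢d : c ≢ d) → a ≡ c → b ≡ d →
            pair a b a≢b ≡ pair c d c≢d
pair-cong _ _ refl refl = refl

′-cong : {α β : Permutation′ n} → α ≈ β → ∀ e → α ′ e ≡ β ′ e
′-cong α≈β ((i , j) , [ i<j ]) = pair-cong _ _ (α≈β i) (α≈β j)

·-cong : {α β : Permutation′ n} → α ≈ β → ∀ G → α · G ≡ β · G
·-cong {α = α} {β} α≈β G = cong graph (Vec.tabulate-cong λ k → does-⇔
  (mk⇔ (λ { (l , l∈G , eq) → l , l∈G , trans (sym (α≡β l)) eq })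
       (λ { (l , l∈G , eq) → l , l∈G , trans (α≡β l) eq }))
  (inImage? α G k) (inImage? β G k))
  where
  α≡β : ∀ l → α ′ pairAt l ≡ β ′ pairAt l
  α≡β l = ′-cong {α = α} {β} α≈β (pairAt l)

selfComplementary? : Decidable (SelfComplementary {n})
selfComplementary? {n} G = map′
  Any.satisfied
  (λ { (α , αG≡Ḡ) → Any.map (λ {β} α≈β → trans (sym (·-cong {α = α} {β} α≈β G)) αG≡Ḡ)
                            (permutations-complete α) })
  (Any.any? (λ α → (α · G) ≟ᵍ complement G) (permutations n))

A-𝒮? : Decidable (A-𝒮 {n})
A-𝒮? α = anyGraph? λ G → selfComplementary? G ×-dec ((α · G) ≟ᵍ complement G)

finite-Graph : ∀ n → Finite (Graph n)
finite-Graph n = finite-↔ (mk↔ₛ′ graph E (λ _ → refl) (λ _ → refl)) (finite-Subset _)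

finite-𝒮 : ∀ n → Finite (𝒮 n)
finite-𝒮 n = finite-refine (finite-Graph n) selfComplementary?

lsc : ℕ → ℕ
lsc n = card (finite-𝒮 n)

-- Vertices are counted from 1 in the formula for p, hence the sucs. The
-- division is exact and no subtraction is truncated.
p : Pair n → ℕ
p {n} ((i′ , j′) , _) = (2 * n ∸ i) * (i ∸ 1) / 2 + (j ∸ i)
  where
  i = suc (toℕ i′)
  j = suc (toℕ j′)

w : Pair n → ℕ
w {n} ij = 2 ^ (n C 2 ∸ p ij)

-- The cycle (e , α ′ e , …) of α′, written from e until e recurs.
cycleFrom : Permutation′ n → Pair n → List (Pair n)
cycleFrom {n} α e =
  e ∷ takeWhile (λ f → ¬? (f ≟ₚ e)) (iterate (α ′_) (α ′ e) (card (finite-Pair n)))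

-- Each cycle of α′ occurs once, written from its element of largest weight.
Z : Permutation′ n → List (List (Pair n))
Z {n} α = map (cycleFrom α)
  (filter (λ e → All.all? (λ f → w f ≤? w e) (cycleFrom α e)) (elements (finite-Pair n)))

P₁ P₂ : List A → List A
P₁ []       = []
P₁ (x ∷ xs) = x ∷ P₂ xs
P₂ []       = []
P₂ (x ∷ xs) = P₁ xs

W₁ W₂ : List (Pair n) → ℕ
W₁ z = sum (map w (P₁ z))
W₂ z = sum (map w (P₂ z))

-- Polynomials over ℕ as coefficient lists, constant term first.

Poly : Set
Poly = List ℕ

coeff : Poly → ℕ → ℕ
coeff []      _       = 0
coeff (a ∷ f) zero    = a
coeff (a ∷ f) (suc L) = coeff f L

x^_ : ℕ → Poly
x^ L = replicate L 0 ++ 1 ∷ []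

infixl 6 _⊕_
infixl 7 _⊗_

_⊕_ : Poly → Poly → Poly
[]      ⊕ g       = g
(a ∷ f) ⊕ []      = a ∷ f
(a ∷ f) ⊕ (b ∷ g) = a + b ∷ f ⊕ g

_⊗_ : Poly → Poly → Poly
[]      ⊗ g = []
(a ∷ f) ⊗ g = map (a *_) g ⊕ (0 ∷ f ⊗ g)

∑ ∏ : List Poly → Poly
∑ = foldr _⊕_ []
∏ = foldr _⊗_ (1 ∷ [])

U[_] : Permutation′ n → Poly
U[ α ] = ∏ (map (λ z → (x^ W₁ z) ⊕ (x^ W₂ z)) (Z α))

U : ℕ → Poly
U n = ∑ (map U[_] (filter A-𝒮? (permutations n)))

Exponents : Poly → Set
Exponents f = [ L ∈ ℕ ∣ coeff f L ≢ 0 ]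

ℒ𝒮 : ℕ → Set
ℒ𝒮 n = Exponents (U n)

coeff≢0⇒<length : ∀ f L → coeff f L ≢ 0 → L ℕ.< length f
coeff≢0⇒<length []      L       c≢0 = contradiction refl c≢0
coeff≢0⇒<length (a ∷ f) zero    c≢0 = s≤s z≤n
coeff≢0⇒<length (a ∷ f) (suc L) c≢0 = s≤s (coeff≢0⇒<length f L c≢0)

finite-Exponents : ∀ f → Finite (Exponents f)
finite-Exponents f = finite-↔
  (mk↔ₛ′
    (Refinement.map toℕ (λ c≢0 → c≢0))
    (λ { (L , [ c≢0 ]) → fromℕ< (coeff≢0⇒<length f L c≢0) ,
           [ subst (λ L → coeff f L ≢ 0)
                   (sym (toℕ-fromℕ< (coeff≢0⇒<length f L c≢0))) c≢0 ] })
    (λ { (L , [ c≢0 ]) → Refinement.value-injective (toℕ-fromℕ< (coeff≢0⇒<length f L c≢0)) })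
    (λ { (i , _) → Refinement.value-injective (fromℕ<-toℕ i (toℕ<n i)) }))
  (finite-refine-Fin (λ i → ¬? (coeff f (toℕ i) ℕ.≟ 0)))

∣ℒ𝒮∣ : ℕ → ℕ
∣ℒ𝒮∣ n = card (finite-Exponents (U n))

{-# OPTIONS --safe #-}
-- Let the weight of a graph be the sum of w over its edges. The weights of the
-- pairs are distinct powers of 2, so a graph is determined by its weight. If
-- α G is the complement of G, membership in G alternates along every cycle of
-- α′, so G meets each cycle z in P₁ z or in P₂ z and its weight is an exponent
-- of U_α. Conversely, if one such G exists, any independent choice of P₁ z or
-- P₂ z on the cycles of α′ again alternates under α′, so every exponent of U_α is
-- the weight of a self-complementary graph.
module Submission where

open import Defs
open import Data.Nat using (ℕ; _≤_; _%_)
open import Data.Sum using (_⊎_)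
open import Relation.Binary.PropositionalEquality using (_≡_)

open import Data.Bool using (Bool; true; false; if_then_else_; not)
import Data.Bool.Properties as Bool
open import Data.Fin as Fin using (Fin; toℕ)
open import Data.Fin.Permutation using (Permutation′; _⟨$⟩ʳ_; flip; inverseˡ; ↔⇒≡)
import Data.Fin.Properties as Fin
open import Data.Irrelevant using ([_])
open import Data.List
  using (List; []; _∷_; _++_; map; concat; filter; iterate; applyUpTo; takeWhile)
open import Data.List.Extrema.Nat using (argmax; argmax-all; f[xs]≤f[argmax])
open import Data.List.Membership.Propositional using (_∈_; _∉_; find)
open import Data.List.Membership.Propositional.Properties
  using (∈-allFin; ∈-map⁺; ∈-map⁻; ∈-filter⁺; ∈-filter⁻; ∈-concat⁺′; ∈-concat⁻′;
         ∈-applyUpTo⁺; ∈-applyUpTo⁻)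
open import Data.List.Membership.Propositional.Properties.WithK using (unique∧set⇒bag)
open import Data.List.Properties using (map-++; map-cong-local)
open import Data.List.Relation.Binary.BagAndSetEquality using (∼bag⇒↭)
open import Data.List.Relation.Binary.Disjoint.Propositional using (Disjoint)
open import Data.List.Relation.Binary.Permutation.Propositional using (_↭_; ↭-sym; ↭⇒↭ₛ)
open import Data.List.Relation.Binary.Permutation.Propositional.Properties using (map⁺; All-resp-↭)
open import Data.List.Relation.Binary.Permutation.Setoid.Properties using (Unique-resp-↭)
open import Data.List.Relation.Unary.All as All using (All; []; _∷_)
import Data.List.Relation.Unary.All.Properties as All
open import Data.List.Relation.Unary.AllPairs as AllPairs using (AllPairs; []; _∷_)
import Data.List.Relation.Unary.AllPairs.Properties as AllPairs
open import Data.List.Relation.Unary.Any using (here; there)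
open import Data.List.Relation.Unary.Sorted.TotalOrder.Properties using (Sorted⇒AllPairs)
open import Data.List.Relation.Unary.Unique.Propositional using (Unique)
import Data.List.Relation.Unary.Unique.Propositional.Properties as Unique
import Data.List.Sort as Sort
open import Data.Nat
  using (zero; suc; pred; _+_; _*_; _∸_; _^_; _/_; _<_; _≟_; _≤?_; _<?_; z≤n; s≤s; s≤s⁻¹; >-nonZero)
open import Data.Nat.Combinatorics using (_C_; nC1≡n; nCk+nC[k+1]≡[n+1]C[k+1])
open import Data.Nat.DivMod using (m*n/n≡m)
open import Data.Nat.GeneralisedArithmetic using () renaming (iterate to _^[_]_)
open import Data.Nat.ListAction using (sum)
open import Data.Nat.ListAction.Properties using (sum-++; sum-↭)
open import Data.Nat.Properties
open import Data.Nat.Tactic.RingSolver using (solve-∀)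
open import Data.Product using (∃; ∃₂; _×_; _,_; proj₁; proj₂)
open import Data.Refinement as Refinement using (_,_; value-injective)
open import Data.Sum using (inj₁; inj₂)
open import Data.Vec using (lookup; tabulate)
import Data.Vec.Properties as Vec
open import Function using (_∘_; case_of_; _↔_; Inverse; Injection; mk⇔; mk↔ₛ′)
open import Function.Construct.Composition using (_↔-∘_)
open import Function.Properties.Inverse using (↔⇒↣; ↔-sym)
open import Relation.Binary using (DecidableEquality; DecTotalOrder; tri<; tri≈; tri>)
import Relation.Binary.Construct.Flip.EqAndOrd as Flip
import Relation.Binary.Construct.On as On
open import Relation.Binary.PropositionalEquality
  using (_≢_; refl; sym; trans; cong; cong₂; subst; subst₂; setoid; module ≡-Reasoning)
open import Relation.Nullary
  using (does; yes; no; ¬?; contradiction; contradiction-irr; recompute)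
open import Relation.Nullary.Decidable using (dec-true; dec-false)
open import Relation.Nullary.Recomputable using (¬-recompute)

private variable
  n : ℕ
  A : Set

-- The weights of pairs

-- rowStart n k is the number of pairs whose smaller element is one of the first k vertices.
rowStart : ℕ → ℕ → ℕ
rowStart n zero    = 0
rowStart n (suc k) = rowStart n k + (n ∸ suc k)

-- The row lengths form an arithmetic series; the left side is the numerator in `p`, so this shows
-- that the division there is exact.
rowStart-closed : ∀ n k → k ≤ n → (2 * n ∸ suc k) * k ≡ rowStart n k * 2
rowStart-closed n zero    _   = *-zeroʳ (2 * n ∸ 1)
rowStart-closed n (suc k) k<n = begin
  (2 * n ∸ suc (suc k)) * suc k          ≡⟨ cong (λ m → (m ∸ suc (suc k)) * suc k) 2n ⟩
  (suc (suc k) + (k + 2 * d) ∸ suc (suc k)) * suc k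
    ≡⟨ cong (_* suc k) (m+n∸m≡n (suc (suc k)) (k + 2 * d)) ⟩
  (k + 2 * d) * suc k                    ≡⟨ expand k d ⟩
  (suc k + 2 * d) * k + d * 2
    ≡⟨ cong (λ m → m * k + d * 2) (m+n∸m≡n (suc k) (suc k + 2 * d)) ⟨
  (suc k + (suc k + 2 * d) ∸ suc k) * k + d * 2
    ≡⟨ cong (λ m → (m ∸ suc k) * k + d * 2) (sym 2n′) ⟩
  (2 * n ∸ suc k) * k + d * 2            ≡⟨ cong (_+ d * 2) (rowStart-closed n k (<⇒≤ k<n)) ⟩
  rowStart n k * 2 + d * 2               ≡⟨ *-distribʳ-+ 2 (rowStart n k) d ⟨
  (rowStart n k + d) * 2                 ∎
  where
  open ≡-Reasoning
  -- Writing `n` as `suc k + d` turns the truncated differences into sums, which the ring solver can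
  -- handle.
  d : ℕ
  d = n ∸ suc k
  expand : ∀ k d → (k + 2 * d) * suc k ≡ (suc k + 2 * d) * k + d * 2
  expand = solve-∀
  split : ∀ k d → 2 * (suc k + d) ≡ suc (suc k) + (k + 2 * d)
  split = solve-∀
  split′ : ∀ k d → 2 * (suc k + d) ≡ suc k + (suc k + 2 * d)
  split′ = solve-∀
  2n : 2 * n ≡ suc (suc k) + (k + 2 * d)
  2n = trans (cong (2 *_) (sym (m+[n∸m]≡n k<n))) (split k d)
  2n′ : 2 * n ≡ suc k + (suc k + 2 * d)
  2n′ = trans (cong (2 *_) (sym (m+[n∸m]≡n k<n))) (split′ k d)

rowStart-mono : ∀ n {k l} → k ≤ l → rowStart n k ≤ rowStart n l
rowStart-mono n {l = zero}  z≤n = z≤n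
rowStart-mono n {k} {suc l} k≤1+l with m≤n⇒m<n∨m≡n k≤1+l
... | inj₁ k≤l  = ≤-trans (rowStart-mono n (s≤s⁻¹ k≤l)) (m≤m+n _ _)
... | inj₂ refl = ≤-refl

-- A vertex added in front heads one new row of `n` pairs, and the old rows follow unchanged.
rowStart-suc : ∀ n k → rowStart (suc n) (suc k) ≡ n + rowStart n k
rowStart-suc n zero    = +-comm 0 n
rowStart-suc n (suc k) = trans (cong (_+ (n ∸ suc k)) (rowStart-suc n k)) (+-assoc n _ _)

-- Both sides grow by `n` from `n` to `suc n`; for the binomial coefficient this is Pascal's rule.
rowStart-all : ∀ n → rowStart n n ≡ n C 2
rowStart-all zero    = refl
rowStart-all (suc n) = begin
  rowStart (suc n) (suc n)  ≡⟨ rowStart-suc n n ⟩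
  n + rowStart n n          ≡⟨ cong₂ _+_ (sym (nC1≡n n)) (rowStart-all n) ⟩
  n C 1 + n C 2             ≡⟨ nCk+nC[k+1]≡[n+1]C[k+1] n 1 ⟩
  suc n C 2                 ∎
  where open ≡-Reasoning

-- Row offset plus position within the row: `p` numbers the pairs lexicographically, starting from
-- 1.
p-rowStart : ∀ {i j : Fin n} .(i<j : i Fin.< j) →
             p ((i , j) , [ i<j ]) ≡ rowStart n (toℕ i) + (toℕ j ∸ toℕ i)
p-rowStart {n} {i} {j} _ = cong (_+ (toℕ j ∸ toℕ i)) (begin
  (2 * n ∸ suc (toℕ i)) * toℕ i / 2  ≡⟨ cong (_/ 2) (rowStart-closed n (toℕ i) (<⇒≤ (Fin.toℕ<n i))) ⟩
  rowStart n (toℕ i) * 2 / 2         ≡⟨ m*n/n≡m (rowStart n (toℕ i)) 2 ⟩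
  rowStart n (toℕ i)                 ∎)
  where open ≡-Reasoning

p≤rowEnd : (e@((i , _) , _) : Pair n) → p e ≤ rowStart n (suc (toℕ i))
p≤rowEnd {n} ((i , j) , [ i<j ]) = begin
  p ((i , j) , [ i<j ])                 ≡⟨ p-rowStart i<j ⟩
  rowStart n (toℕ i) + (toℕ j ∸ toℕ i)
    ≤⟨ +-monoʳ-≤ (rowStart n (toℕ i)) (∸-monoˡ-≤ (suc (toℕ i)) (Fin.toℕ<n j)) ⟩
  rowStart n (suc (toℕ i))              ∎
  where open ≤-Reasoning

p≤nC2 : (e : Pair n) → p e ≤ n C 2
p≤nC2 {n} e@((i , j) , _) = begin
  p e                       ≤⟨ p≤rowEnd e ⟩
  rowStart n (suc (toℕ i))  ≤⟨ rowStart-mono n (Fin.toℕ<n i) ⟩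
  rowStart n n              ≡⟨ rowStart-all n ⟩
  n C 2                     ∎
  where open ≤-Reasoning

-- The row of `i` ends no later than the row of `i′` starts, and positions inside a row begin at 1,
-- which gives strictness.
p-mono-rows : (e@((i , _) , _) e′@((i′ , _) , _) : Pair n) → i Fin.< i′ → p e < p e′
p-mono-rows {n} e@((i , _) , _) e′@((i′ , j′) , [ i′<j′ ]) i<i′ = begin-strict
  p e                                       ≤⟨ p≤rowEnd e ⟩
  rowStart n (suc (toℕ i))                  ≤⟨ rowStart-mono n i<i′ ⟩
  -- The order proof inside a pair is irrelevant; a usable one is recovered by deciding the
  -- inequality.
  rowStart n (toℕ i′)                       <⟨ m<m+n _ (m<n⇒0<n∸m (recompute (toℕ i′ <? toℕ j′) i′<j′)) ⟩
  rowStart n (toℕ i′) + (toℕ j′ ∸ toℕ i′)   ≡⟨ p-rowStart i′<j′ ⟨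
  p e′                                      ∎
  where open ≤-Reasoning

p-injective : (e e′ : Pair n) → p e ≡ p e′ → e ≡ e′
p-injective {n} e@((i , j) , [ i<j ]) e′@((i′ , j′) , [ i′<j′ ]) eq with <-cmp (toℕ i) (toℕ i′)
... | tri< i<i′ _ _ = contradiction eq (<⇒≢ (p-mono-rows e e′ i<i′))
... | tri> _ _ i′<i = contradiction (sym eq) (<⇒≢ (p-mono-rows e′ e i′<i))
... | tri≈ _ i≡i′ _ with refl ← Fin.toℕ-injective i≡i′ =
  value-injective (cong (i ,_) (Fin.toℕ-injective (∸-cancelʳ-≡
    (<⇒≤ (recompute (toℕ i <? toℕ j) i<j)) (<⇒≤ (recompute (toℕ i <? toℕ j′) i′<j′))
    (+-cancelˡ-≡ (rowStart n (toℕ i)) _ _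
      (trans (sym (p-rowStart i<j)) (trans eq (p-rowStart i′<j′)))))))

log₂w : Pair n → ℕ
log₂w {n} e = n C 2 ∸ p e

-- Since `p` never exceeds `n C 2`, the subtraction is not truncated and can be cancelled.
log₂w-injective : {e e′ : Pair n} → log₂w e ≡ log₂w e′ → e ≡ e′
log₂w-injective {n} {e} {e′} eq = p-injective e e′ (∸-cancelˡ-≡ (p≤nC2 e) (p≤nC2 e′) eq)

2^-injective : ∀ {a b} → 2 ^ a ≡ 2 ^ b → a ≡ b
2^-injective {a} {b} eq with <-cmp a b
... | tri< a<b _ _ = contradiction eq (<⇒≢ (^-monoʳ-< 2 (s≤s (s≤s z≤n)) a<b))
... | tri≈ _ a≡b _ = a≡b
... | tri> _ _ b<a = contradiction (sym eq) (<⇒≢ (^-monoʳ-< 2 (s≤s (s≤s z≤n)) b<a))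

w-injective : {e e′ : Pair n} → w e ≡ w e′ → e ≡ e′
w-injective = log₂w-injective ∘ 2^-injective

-- Subset sums

-- The subset is a Boolean function and the list stays fixed, so that sums over different subsets
-- can be compared term by term.
subsetSum : (A → ℕ) → (A → Bool) → List A → ℕ
subsetSum v g xs = sum (map (λ x → if g x then v x else 0) xs)

module _ (v : A → ℕ) where

  subsetSum-cong : ∀ {g h xs} → All (λ x → g x ≡ h x) xs → subsetSum v g xs ≡ subsetSum v h xs
  subsetSum-cong g≡h = cong sum (map-cong-local (All.map (cong (if_then _ else 0)) g≡h))

  subsetSum-++ : ∀ g xs ys → subsetSum v g (xs ++ ys) ≡ subsetSum v g xs + subsetSum v g ys
  subsetSum-++ g xs ys = trans (cong sum (map-++ _ xs ys)) (sum-++ (map _ xs) (map _ ys))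

  subsetSum-↭ : ∀ g {xs ys} → xs ↭ ys → subsetSum v g xs ≡ subsetSum v g ys
  subsetSum-↭ g xs↭ys = sum-↭ (map⁺ _ xs↭ys)

module _ {A : Set} (q : A → ℕ) where

  private
    Descending : List A → Set
    Descending = AllPairs (λ x y → q y < q x)

    Σ2^ : (A → Bool) → List A → ℕ
    Σ2^ = subsetSum (λ x → 2 ^ q x)

  -- By induction the tail sums to less than `2 ^ q x`, so the whole stays below twice that power.
  subsetSum-bound : ∀ g {xs m} → Descending xs → All (λ x → q x < m) xs → Σ2^ g xs < 2 ^ m
  subsetSum-bound g {m = m} [] [] = m^n>0 2 m
  subsetSum-bound g {x ∷ xs} {m} (x>xs ∷ desc) (x<m ∷ _) = begin-strict
    (if g x then 2 ^ q x else 0) + Σ2^ g xs  <⟨ +-mono-≤-< (term (g x)) (subsetSum-bound g desc x>xs) ⟩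
    2 ^ q x + 2 ^ q x                        ≡⟨ cong (2 ^ q x +_) (+-identityʳ (2 ^ q x)) ⟨
    2 ^ suc (q x)                            ≤⟨ ^-monoʳ-≤ 2 x<m ⟩
    2 ^ m                                    ∎
    where
    open ≤-Reasoning
    term : ∀ b → (if b then 2 ^ q x else 0) ≤ 2 ^ q x
    term true  = ≤-refl
    term false = z≤n

  -- Uniqueness of the binary expansion, read from the leading digit down.
  subsetSum-injective-descending :
    ∀ g h {xs} → Descending xs → Σ2^ g xs ≡ Σ2^ h xs → All (λ x → g x ≡ h x) xs
  subsetSum-injective-descending g h {[]}     _             _  = []
  subsetSum-injective-descending g h {x ∷ xs} (x>xs ∷ desc) eq =
    proj₁ step ∷ subsetSum-injective-descending g h desc (proj₂ step)
    where
    -- The largest power exceeds the sum of all smaller ones.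
    digit : ∀ b c {r s} → r < 2 ^ q x → s < 2 ^ q x →
            (if b then 2 ^ q x else 0) + r ≡ (if c then 2 ^ q x else 0) + s → b ≡ c × r ≡ s
    digit true  true  _   _   eq = refl , +-cancelˡ-≡ (2 ^ q x) _ _ eq
    digit true  false _   s<  eq =
      contradiction (≤-<-trans (m≤m+n _ _) (subst (_< 2 ^ q x) (sym eq) s<)) (n≮n _)
    digit false true  r<  _   eq =
      contradiction (≤-<-trans (m≤m+n _ _) (subst (_< 2 ^ q x) eq r<)) (n≮n _)
    digit false false _   _   eq = refl , eq
    step : g x ≡ h x × Σ2^ g xs ≡ Σ2^ h xs
    step = digit (g x) (h x) (subsetSum-bound g desc x>xs) (subsetSum-bound h desc x>xs) eq

  -- Reordering changes no subset sum, so the list may be sorted by decreasing exponent; uniqueness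
  -- and injectivity make the descent strict.
  subsetSum-injective : (∀ {x y} → q x ≡ q y → x ≡ y) → ∀ g h {xs} → Unique xs →
                        Σ2^ g xs ≡ Σ2^ h xs → All (λ x → g x ≡ h x) xs
  subsetSum-injective q-inj g h {xs} uniq eq =
    All-resp-↭ (sort-↭ xs) (subsetSum-injective-descending g h descending (begin
      Σ2^ g (sort xs)  ≡⟨ subsetSum-↭ (λ x → 2 ^ q x) g (sort-↭ xs) ⟩
      Σ2^ g xs         ≡⟨ eq ⟩
      Σ2^ h xs         ≡⟨ subsetSum-↭ (λ x → 2 ^ q x) h (sort-↭ xs) ⟨
      Σ2^ h (sort xs)  ∎))
    where
    open ≡-Reasoning
    order = On.decTotalOrder (Flip.decTotalOrder ≤-decTotalOrder) q
    open Sort order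
    descending : Descending (sort xs)
    descending = AllPairs.zipWith (λ (y≤x , x≢y) → ≤∧≢⇒< y≤x (x≢y ∘ sym ∘ q-inj))
      ( Sorted⇒AllPairs (DecTotalOrder.totalOrder order) (sort-↗ xs)
      , Unique-resp-↭ (setoid A) (↭⇒↭ₛ (↭-sym (sort-↭ xs))) uniq )

-- Cycles of an injection of a finite set

module _ (fin : Finite A) where
  open Finite fin

  ∈-elements : ∀ x → x ∈ elements
  ∈-elements x = subst (_∈ elements) (Inverse.strictlyInverseˡ enum x)
    (∈-map⁺ element (∈-allFin (Inverse.from enum x)))

  elements-unique : Unique elements
  elements-unique = Unique.map⁺ (Injection.injective (↔⇒↣ enum)) (Unique.allFin⁺ card)

module Cycles {A : Set} (fin : Finite A) (_≟ᴬ_ : DecidableEquality A)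
              (f : A → A) (f-injective : ∀ {x y} → f x ≡ f y → x ≡ y) where

  open Finite fin
  open ≡-Reasoning

  infix 8 f^_

  f^_ : ℕ → A → A
  (f^ i) x = f ^[ x ] i

  -- This has the shape of `cycleFrom`, so results about a general injection apply to α′ by
  -- unfolding.
  cycle : A → List A
  cycle e = e ∷ takeWhile (λ g → ¬? (g ≟ᴬ e)) (iterate f (f e) card)

  -- By definition `(f^ suc i) x` unfolds to `(f^ i) (f x)`; the other form has the last application
  -- outermost.
  f^-suc : ∀ i x → (f^ suc i) x ≡ f ((f^ i) x)
  f^-suc zero    x = refl
  f^-suc (suc i) x = f^-suc i (f x)

  f^-+ : ∀ i j x → (f^ (i + j)) x ≡ (f^ j) ((f^ i) x)
  f^-+ zero    j x = refl
  f^-+ (suc i) j x = f^-+ i j (f x)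

  f^-injective : ∀ i {x y} → (f^ i) x ≡ (f^ i) y → x ≡ y
  f^-injective zero    eq = eq
  f^-injective (suc i) eq = f-injective (f^-injective i eq)

  f^-returns : ∀ {i j} e → i < j → (f^ i) e ≡ (f^ j) e → (f^ (j ∸ i)) e ≡ e
  f^-returns {i} {j} e i<j eq = f^-injective i (begin
    (f^ i) ((f^ (j ∸ i)) e)  ≡⟨ f^-+ (j ∸ i) i e ⟨
    (f^ (j ∸ i + i)) e       ≡⟨ cong (λ m → (f^ m) e) (m∸n+n≡m (<⇒≤ i<j)) ⟩
    (f^ j) e                 ≡⟨ eq ⟨
    (f^ i) e                 ∎)

  -- Among the `card + 1` iterates with indices 0 to `card` two coincide, and injectivity cancels
  -- the shorter one.
  returns : ∀ e → ∃ λ m → m < card × (f^ suc m) e ≡ e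
  returns e with Fin.pigeonhole (n<1+n card) (λ i → Inverse.from enum ((f^ toℕ i) e))
  -- The iteration in `cycle` starts at `f e`, hence the predecessor; the return time is at most
  -- `card`, so the list of length `card` reaches it.
  ... | i , j , i<j , eq = pred (toℕ j ∸ toℕ i) ,
    <-≤-trans (pred-∸ _ _ i<j) (Fin.toℕ≤pred[n] j) ,
    trans (cong (λ m → (f^ m) e) (suc-pred _ {{>-nonZero (m<n⇒0<n∸m i<j)}}))
      (f^-returns e i<j (Injection.injective (↔⇒↣ (↔-sym enum)) eq))
    where
    pred-∸ : ∀ i j → i < j → pred (j ∸ i) < j
    pred-∸ i (suc j) i<j rewrite +-∸-assoc 1 (s≤s⁻¹ i<j) = s≤s (m∸n≤m j i)

  iterate≡applyUpTo : ∀ x k → iterate f x k ≡ applyUpTo (λ i → (f^ i) x) k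
  iterate≡applyUpTo x zero    = refl
  iterate≡applyUpTo x (suc k) = cong (x ∷_) (iterate≡applyUpTo (f x) k)

  -- Some visit to `e` lies within the list, so `takeWhile` stops at the first visit, at index `k`,
  -- and not at the end of the list.
  takeWhile-iterate : ∀ e x N → (∃ λ m → m < N × (f^ m) x ≡ e) →
    ∃ λ k → takeWhile (λ g → ¬? (g ≟ᴬ e)) (iterate f x N) ≡ iterate f x k ×
            (f^ k) x ≡ e × (∀ i → i < k → (f^ i) x ≢ e)
  takeWhile-iterate e x (suc N) (m , m<N , eq) with x ≟ᴬ e
  takeWhile-iterate e x (suc N) _ | yes x≡e = 0 , refl , x≡e , λ _ ()
  takeWhile-iterate e x (suc N) (zero , _ , eq) | no x≢e = contradiction eq x≢e
  takeWhile-iterate e x (suc N) (suc m , m<N , eq) | no x≢e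
    with takeWhile-iterate e (f x) N (m , s≤s⁻¹ m<N , eq)
  ... | k , takes , stops , first = suc k , cong (x ∷_) takes , stops ,
    λ { zero _ → x≢e ; (suc i) i<k → first i (s≤s⁻¹ i<k) }

  -- The period is suc k, since cycle e is never empty.
  record IsPeriod (e : A) (k : ℕ) : Set where
    field
      cycle≡iterate : cycle e ≡ iterate f e (suc k)
      returns-to    : (f^ suc k) e ≡ e
      first-return  : ∀ i → i < k → (f^ suc i) e ≢ e

    cycle≡applyUpTo : cycle e ≡ applyUpTo (λ i → (f^ i) e) (suc k)
    cycle≡applyUpTo = trans cycle≡iterate (iterate≡applyUpTo e (suc k))

  open IsPeriod

  period : ∀ e → ∃ (IsPeriod e)
  period e with takeWhile-iterate e (f e) card (returns e)
  ... | k , takes , stops , first = k , record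
    { cycle≡iterate = cong (e ∷_) takes ; returns-to = stops ; first-return = first }

  ∈-cycle⁻ : ∀ {x e} → x ∈ cycle e → ∃ λ i → i ≤ proj₁ (period e) × x ≡ (f^ i) e
  ∈-cycle⁻ {x} {e} x∈ with ∈-applyUpTo⁻ _ (subst (x ∈_) (cycle≡applyUpTo (proj₂ (period e))) x∈)
  ... | i , i<k , x≡ = i , s≤s⁻¹ i<k , x≡

  f^∈cycle : ∀ i e → i ≤ proj₁ (period e) → (f^ i) e ∈ cycle e
  f^∈cycle i e i≤k = subst ((f^ i) e ∈_) (sym (cycle≡applyUpTo (proj₂ (period e))))
    (∈-applyUpTo⁺ (λ j → (f^ j) e) (s≤s i≤k))

  f∈cycle : ∀ {x e} → x ∈ cycle e → f x ∈ cycle e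
  f∈cycle {e = e} x∈ with ∈-cycle⁻ x∈
  ... | i , i≤k , refl with m≤n⇒m<n∨m≡n i≤k
  ... | inj₁ i<k = subst (_∈ cycle e) (f^-suc i e) (f^∈cycle (suc i) e i<k)
  ... | inj₂ refl = here (trans (sym (f^-suc i e)) (returns-to (proj₂ (period e))))

  ∈-cycle⁺ : ∀ i {e x} → x ∈ cycle e → (f^ i) x ∈ cycle e
  ∈-cycle⁺ zero    x∈ = x∈
  ∈-cycle⁺ (suc i) x∈ = ∈-cycle⁺ i (f∈cycle x∈)

  ∈-cycle-trans : ∀ {x y z} → x ∈ cycle y → y ∈ cycle z → x ∈ cycle z
  ∈-cycle-trans x∈ y∈ with ∈-cycle⁻ x∈
  ... | i , _ , refl = ∈-cycle⁺ i y∈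

  -- After `i` steps from `y`, the remaining `suc k ∸ i` steps of the period lead back to `y`.
  ∈-cycle-sym : ∀ {x y} → x ∈ cycle y → y ∈ cycle x
  ∈-cycle-sym {y = y} x∈ with ∈-cycle⁻ x∈
  ... | i , i≤k , refl = subst (_∈ cycle ((f^ i) y)) back (∈-cycle⁺ (suc k ∸ i) (here refl))
    where
    k = proj₁ (period y)
    back : (f^ (suc k ∸ i)) ((f^ i) y) ≡ y
    back = begin
      (f^ (suc k ∸ i)) ((f^ i) y)  ≡⟨ f^-+ i (suc k ∸ i) y ⟨
      (f^ (i + (suc k ∸ i))) y     ≡⟨ cong (λ m → (f^ m) y) (m+[n∸m]≡n (m≤n⇒m≤1+n i≤k)) ⟩
      (f^ suc k) y                 ≡⟨ returns-to (proj₂ (period y)) ⟩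
      y                            ∎

  f∈cycle⁻ : ∀ {x e} → f x ∈ cycle e → x ∈ cycle e
  f∈cycle⁻ = ∈-cycle-trans (∈-cycle-sym (f∈cycle (here refl)))

  f-surjective : ∀ y → ∃ λ x → f x ≡ y
  f-surjective y with period y
  ... | k , isPeriod = (f^ k) y , trans (sym (f^-suc k y)) (returns-to isPeriod)

  -- A repetition at positions `i < j` would bring `e` back after `j ∸ i` steps, earlier than its
  -- first return.
  cycle-unique : ∀ e → Unique (cycle e)
  cycle-unique e with period e
  ... | k , isPeriod = subst Unique (sym (cycle≡applyUpTo isPeriod))
    (Unique.applyUpTo⁺₁ _ (suc k) distinct)
    where
    distinct : ∀ {i j} → i < j → j < suc k → (f^ i) e ≢ (f^ j) e
    distinct {i} {suc j} i<j j<k eq = first-return isPeriod (j ∸ i)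
      (≤-<-trans (m∸n≤m j i) (s≤s⁻¹ j<k))
      (trans (cong (λ m → (f^ m) e) (sym (+-∸-assoc 1 (s≤s⁻¹ i<j)))) (f^-returns e i<j eq))

  module _ (v : A → ℕ) (v-injective : ∀ {x y} → v x ≡ v y → x ≡ y) where

    IsTop : A → Set
    IsTop e = All (λ g → v g ≤ v e) (cycle e)

    tops : List A
    tops = filter (λ e → All.all? (λ g → v g ≤? v e) (cycle e)) elements

    cycles : List (List A)
    cycles = map cycle tops

    -- The element of largest value on the cycle of `x` is among the `tops`, and its cycle contains
    -- `x`.
    ∈-concat-cycles : ∀ x → x ∈ concat cycles
    ∈-concat-cycles x = ∈-concat⁺′ {vs = cycle top} (∈-cycle-sym top∈)
      (∈-map⁺ cycle (∈-filter⁺ _ (∈-elements fin top) (All.tabulate λ y∈ →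
        All.lookup (f[xs]≤f[argmax] {f = v} x (cycle x)) (∈-cycle-trans y∈ top∈))))
      where
      -- The default `x` of `argmax` lies on the cycle itself, so the maximum does too.
      top = argmax v x (cycle x)
      top∈ : top ∈ cycle x
      top∈ = argmax-all v (here refl) (All.tabulate λ y∈ → y∈)

    -- Two cycles that meet have the same elements, so their tops bound each other's value and
    -- coincide.
    tops-disjoint : AllPairs (λ x y → Disjoint (cycle x) (cycle y)) tops
    tops-disjoint = disjoint (Unique.filter⁺ _ (elements-unique fin)) (All.all-filter _ elements)
      where
      disjoint₂ : ∀ {x y} → x ≢ y → IsTop x → IsTop y → Disjoint (cycle x) (cycle y)
      disjoint₂ x≢y x-top y-top (z∈x , z∈y) = x≢y (v-injective
        (≤-antisym (All.lookup y-top (∈-cycle-sym y∈x)) (All.lookup x-top y∈x)))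
        where y∈x = ∈-cycle-trans (∈-cycle-sym z∈y) z∈x
      disjoint : ∀ {es} → Unique es → All IsTop es → AllPairs (λ x y → Disjoint (cycle x) (cycle y)) es
      disjoint []              []             = []
      disjoint (x≢es ∷ unique) (x-top ∷ tops) =
        All.zipWith (λ (x≢y , y-top) {_} → disjoint₂ x≢y x-top y-top) (x≢es , tops)
        ∷ disjoint unique tops

    -- Both lists are free of repetitions and contain every element; hence sums over all cycles are
    -- sums over all elements.
    concat-cycles↭elements : concat cycles ↭ elements
    concat-cycles↭elements = ∼bag⇒↭ (unique∧set⇒bag
      (Unique.concat⁺ (All.map⁺ (All.tabulate λ _ → cycle-unique _)) (AllPairs.map⁺ tops-disjoint))
      (elements-unique fin)
      (mk⇔ (λ _ → ∈-elements fin _) (λ _ → ∈-concat-cycles _)))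

-- Exponents of sums and products

coeff-⊕ : ∀ f g L → coeff (f ⊕ g) L ≡ coeff f L + coeff g L
coeff-⊕ []      g       L       = refl
coeff-⊕ (a ∷ f) []      L       = sym (+-identityʳ _)
coeff-⊕ (a ∷ f) (b ∷ g) zero    = refl
coeff-⊕ (a ∷ f) (b ∷ g) (suc L) = coeff-⊕ f g L

coeff-scale : ∀ a g L → coeff (map (a *_) g) L ≡ a * coeff g L
coeff-scale a []      L       = sym (*-zeroʳ a)
coeff-scale a (b ∷ g) zero    = refl
coeff-scale a (b ∷ g) (suc L) = coeff-scale a g L

coeff-⊗ : ∀ a f g L → coeff ((a ∷ f) ⊗ g) L ≡ a * coeff g L + coeff (0 ∷ f ⊗ g) L
coeff-⊗ a f g L = trans (coeff-⊕ (map (a *_) g) _ L)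
  (cong (_+ coeff (0 ∷ f ⊗ g) L) (coeff-scale a g L))

infix 4 _occursIn_

_occursIn_ : ℕ → Poly → Set
L occursIn f = coeff f L ≢ 0

occursIn-⊕⁻ : ∀ f g {L} → L occursIn f ⊕ g → L occursIn f ⊎ L occursIn g
occursIn-⊕⁻ f g {L} occurs with coeff f L ≟ 0
... | no  f≢0 = inj₁ f≢0
... | yes f≡0 = inj₂ λ g≡0 → occurs (trans (coeff-⊕ f g L) (cong₂ _+_ f≡0 g≡0))

-- Coefficients are natural numbers, so nothing cancels.
occursIn-⊕⁺ˡ : ∀ f g {L} → L occursIn f → L occursIn f ⊕ g
occursIn-⊕⁺ˡ f g {L} f≢0 eq = f≢0 (m+n≡0⇒m≡0 (coeff f L) (trans (sym (coeff-⊕ f g L)) eq))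

occursIn-⊕⁺ʳ : ∀ f g {L} → L occursIn g → L occursIn f ⊕ g
occursIn-⊕⁺ʳ f g {L} g≢0 eq = g≢0 (m+n≡0⇒n≡0 (coeff f L) (trans (sym (coeff-⊕ f g L)) eq))

occursIn-x^⁻ : ∀ K {L} → L occursIn x^ K → L ≡ K
occursIn-x^⁻ zero    {zero}  _      = refl
occursIn-x^⁻ zero    {suc L} occurs = contradiction refl occurs
occursIn-x^⁻ (suc K) {zero}  occurs = contradiction refl occurs
occursIn-x^⁻ (suc K) {suc L} occurs = cong suc (occursIn-x^⁻ K occurs)

occursIn-x^⁺ : ∀ K → K occursIn x^ K
occursIn-x^⁺ zero    ()
occursIn-x^⁺ (suc K) = occursIn-x^⁺ K

-- A nonzero coefficient comes from the constant term of the left factor or, shifted by one, from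
-- the product with the rest of it.
occursIn-⊗⁻ : ∀ f g {L} → L occursIn f ⊗ g →
              ∃₂ λ i j → i occursIn f × j occursIn g × L ≡ i + j
occursIn-⊗⁻ []      g     occurs = contradiction refl occurs
occursIn-⊗⁻ (a ∷ f) g {L} occurs with a * coeff g L ≟ 0
... | no ag≢0 = 0 , L , (λ { refl → ag≢0 refl }) ,
  (λ g≡0 → ag≢0 (trans (cong (a *_) g≡0) (*-zeroʳ a))) , refl
... | yes ag≡0 = shifted L λ eq → occurs (trans (coeff-⊗ a f g L) (cong₂ _+_ ag≡0 eq))
  where
  shifted : ∀ L → L occursIn (0 ∷ f ⊗ g) → ∃₂ λ i j → i occursIn (a ∷ f) × j occursIn g × L ≡ i + j
  shifted zero    occurs = contradiction refl occurs
  shifted (suc L) occurs with occursIn-⊗⁻ f g occurs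
  ... | i , j , i∈f , j∈g , L≡ = suc i , j , i∈f , j∈g , cong suc L≡

-- The product of two nonzero coefficients is nonzero, and the other contributions to `i + j` cannot
-- cancel it.
occursIn-⊗⁺ : ∀ f g {i j} → i occursIn f → j occursIn g → i + j occursIn f ⊗ g
occursIn-⊗⁺ []      g             i∈f j∈g eq = i∈f refl
occursIn-⊗⁺ (a ∷ f) g {zero}  {j} a≢0 j∈g eq
  with m*n≡0⇒m≡0∨n≡0 a (m+n≡0⇒m≡0 (a * coeff g j) (trans (sym (coeff-⊗ a f g j)) eq))
... | inj₁ a≡0 = a≢0 a≡0
... | inj₂ g≡0 = j∈g g≡0
occursIn-⊗⁺ (a ∷ f) g {suc i} {j} i∈f j∈g eq = occursIn-⊗⁺ f g i∈f j∈g
  (m+n≡0⇒n≡0 (a * coeff g (suc i + j)) (trans (sym (coeff-⊗ a f g (suc i + j))) eq))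

occursIn-∑⁻ : ∀ (h : A → Poly) xs {L} → L occursIn ∑ (map h xs) → ∃ λ x → x ∈ xs × L occursIn h x
occursIn-∑⁻ h []       occurs = contradiction refl occurs
occursIn-∑⁻ h (x ∷ xs) occurs with occursIn-⊕⁻ (h x) (∑ (map h xs)) occurs
... | inj₁ in-hx = x , here refl , in-hx
... | inj₂ in-∑  with y , y∈ , in-hy ← occursIn-∑⁻ h xs in-∑ = y , there y∈ , in-hy

occursIn-∑⁺ : ∀ (h : A → Poly) {x xs} → x ∈ xs → ∀ {L} → L occursIn h x → L occursIn ∑ (map h xs)
occursIn-∑⁺ h {xs = y ∷ xs} (here refl) in-hx = occursIn-⊕⁺ˡ (h y) (∑ (map h xs)) in-hx
occursIn-∑⁺ h {xs = y ∷ xs} (there x∈)  in-hx =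
  occursIn-⊕⁺ʳ (h y) (∑ (map h xs)) (occursIn-∑⁺ h x∈ in-hx)

-- Sets alternating along every cycle

module Alternation {A : Set} (fin : Finite A) (_≟ᴬ_ : DecidableEquality A)
                   (f : A → A) (f-injective : ∀ {x y} → f x ≡ f y → x ≡ y) (v : A → ℕ) where

  open Cycles fin _≟ᴬ_ f f-injective
  open import Data.List.Membership.DecPropositional _≟ᴬ_ using (_∈?_)

  -- For the indicator of an edge set and `f` equal to α′, this expresses that α maps the graph to
  -- its complement.
  Alternates : (A → Bool) → Set
  Alternates g = ∀ x → g (f x) ≡ not (g x)

  factor : List A → Poly
  factor z = (x^ sum (map v (P₁ z))) ⊕ (x^ sum (map v (P₂ z)))

  factor-P₁ : ∀ z → sum (map v (P₁ z)) occursIn factor z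
  factor-P₁ z = occursIn-⊕⁺ˡ (x^ sum (map v (P₁ z))) (x^ sum (map v (P₂ z))) (occursIn-x^⁺ (sum (map v (P₁ z))))

  factor-P₂ : ∀ z → sum (map v (P₂ z)) occursIn factor z
  factor-P₂ z = occursIn-⊕⁺ʳ (x^ sum (map v (P₁ z))) _ (occursIn-x^⁺ (sum (map v (P₂ z))))

  module _ {g} (alt : Alternates g) where

    -- One step along the orbit flips membership and exchanges `P₁` with `P₂`, hence the mutual
    -- induction. It runs over `iterate`, whose tail is again of that form.
    sum-P₁ : ∀ e k → g e ≡ true  → subsetSum v g (iterate f e k) ≡ sum (map v (P₁ (iterate f e k)))
    sum-P₂ : ∀ e k → g e ≡ false → subsetSum v g (iterate f e k) ≡ sum (map v (P₂ (iterate f e k)))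
    sum-P₁ e zero    _  = refl
    sum-P₁ e (suc k) ge rewrite ge = cong (v e +_) (sum-P₂ (f e) k (trans (alt e) (cong not ge)))
    sum-P₂ e zero    _  = refl
    sum-P₂ e (suc k) ge rewrite ge = sum-P₁ (f e) k (trans (alt e) (cong not ge))

    sum-P₁-cycle : ∀ e → g e ≡ true → subsetSum v g (cycle e) ≡ sum (map v (P₁ (cycle e)))
    sum-P₁-cycle e ge with period e
    ... | k , isPeriod = subst (λ z → subsetSum v g z ≡ sum (map v (P₁ z)))
      (sym (IsPeriod.cycle≡iterate isPeriod)) (sum-P₁ e (suc k) ge)

    sum-P₂-cycle : ∀ e → g e ≡ false → subsetSum v g (cycle e) ≡ sum (map v (P₂ (cycle e)))
    sum-P₂-cycle e ge with period e
    ... | k , isPeriod = subst (λ z → subsetSum v g z ≡ sum (map v (P₂ z)))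
      (sym (IsPeriod.cycle≡iterate isPeriod)) (sum-P₂ e (suc k) ge)

    -- Negation preserves alternation, so the value at one element can be prescribed.
    alternates-with : ∀ e b → ∃ λ h → Alternates h × h e ≡ b
    alternates-with e b with g e Bool.≟ b
    ... | yes ge≡b = g , alt , ge≡b
    ... | no  ge≢b = not ∘ g , cong not ∘ alt , sym (Bool.¬-not (ge≢b ∘ sym))

    factor-occurs⁺ : ∀ e → subsetSum v g (cycle e) occursIn factor (cycle e)
    factor-occurs⁺ e = starting-with (g e) refl
      where
      starting-with : ∀ b → g e ≡ b → subsetSum v g (cycle e) occursIn factor (cycle e)
      starting-with true  ge = subst (_occursIn factor (cycle e))
        (sym (sum-P₁-cycle e ge)) (factor-P₁ (cycle e))
      starting-with false ge = subst (_occursIn factor (cycle e))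
        (sym (sum-P₂-cycle e ge)) (factor-P₂ (cycle e))

  -- The exponent of `P₁` is realised by an alternating function that is true at `e`, that of `P₂`
  -- by one that is false there.
  factor-occurs⁻ : ∀ {g} → Alternates g → ∀ e {L} → L occursIn factor (cycle e) →
                   ∃ λ h → Alternates h × L ≡ subsetSum v h (cycle e)
  factor-occurs⁻ alt e occurs
    with occursIn-⊕⁻ (x^ sum (map v (P₁ (cycle e)))) (x^ sum (map v (P₂ (cycle e)))) occurs
  ... | inj₁ in-P₁ with h , h-alt , he ← alternates-with alt e true =
    h , h-alt , trans (occursIn-x^⁻ _ in-P₁) (sym (sum-P₁-cycle h-alt e he))
  ... | inj₂ in-P₂ with h , h-alt , he ← alternates-with alt e false =
    h , h-alt , trans (occursIn-x^⁻ _ in-P₂) (sym (sum-P₂-cycle h-alt e he))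

  splice : A → (g h : A → Bool) → A → Bool
  splice e g h x = if does (x ∈? cycle e) then g x else h x

  splice-∈ : ∀ e g h {x} → x ∈ cycle e → g x ≡ splice e g h x
  splice-∈ e g h {x} x∈ rewrite dec-true (x ∈? cycle e) x∈ = refl

  splice-∉ : ∀ e g h {x} → x ∉ cycle e → h x ≡ splice e g h x
  splice-∉ e g h {x} x∉ rewrite dec-false (x ∈? cycle e) x∉ = refl

  -- A cycle contains `x` exactly when it contains `f x`, so both values are taken from the same
  -- function.
  splice-alternates : ∀ e {g h} → Alternates g → Alternates h → Alternates (splice e g h)
  splice-alternates e {g} {h} g-alt h-alt x = case x ∈? cycle e of λ where
    (yes x∈) → trans (sym (splice-∈ e g h (f∈cycle x∈)))
                     (trans (g-alt x) (cong not (splice-∈ e g h x∈)))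
    (no  x∉) → trans (sym (splice-∉ e g h (x∉ ∘ f∈cycle⁻)))
                     (trans (h-alt x) (cong not (splice-∉ e g h x∉)))

  product-occurs⁺ : ∀ {g} → Alternates g → ∀ es →
                    subsetSum v g (concat (map cycle es)) occursIn ∏ (map factor (map cycle es))
  product-occurs⁺     alt []       ()
  product-occurs⁺ {g} alt (e ∷ es) = subst (_occursIn ∏ (map factor (map cycle (e ∷ es))))
    (sym (subsetSum-++ v g (cycle e) (concat (map cycle es))))
    (occursIn-⊗⁺ (factor (cycle e)) _ (factor-occurs⁺ alt e) (product-occurs⁺ alt es))

  -- The choices for the first cycle and for the others are spliced; disjointness keeps each partial
  -- sum unchanged.
  product-occurs⁻ : ∀ {g} → Alternates g → ∀ {es L} →
                    AllPairs (λ x y → Disjoint (cycle x) (cycle y)) es →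
                    L occursIn ∏ (map factor (map cycle es)) →
                    ∃ λ h → Alternates h × L ≡ subsetSum v h (concat (map cycle es))
  -- The empty product computes to `x^ 0`, and the empty subset sum is 0.
  product-occurs⁻ {g} alt {[]}     _             occurs = g , alt , occursIn-x^⁻ 0 occurs
  product-occurs⁻ {g} alt {e ∷ es} (disj ∷ disjs) occurs
    with i , j , in-e , in-es , L≡i+j ← occursIn-⊗⁻ (factor (cycle e)) _ occurs
    with h  , h-alt  , i≡ ← factor-occurs⁻ alt e in-e
    with h′ , h′-alt , j≡ ← product-occurs⁻ alt disjs in-es =
    splice e h h′ , splice-alternates e h-alt h′-alt , (begin
      _                                            ≡⟨ L≡i+j ⟩
      i + j                                        ≡⟨ cong₂ _+_ i≡ j≡ ⟩
      subsetSum v h (cycle e) + subsetSum v h′ (concat (map cycle es))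
        ≡⟨ cong₂ _+_ (subsetSum-cong v (All.tabulate (splice-∈ e h h′)))
                     (subsetSum-cong v (All.tabulate (splice-∉ e h h′ ∘ elsewhere))) ⟩
      subsetSum v (splice e h h′) (cycle e) + subsetSum v (splice e h h′) (concat (map cycle es))
        ≡⟨ subsetSum-++ v (splice e h h′) (cycle e) (concat (map cycle es)) ⟨
      subsetSum v (splice e h h′) (concat (map cycle (e ∷ es)))  ∎)
    where
    open ≡-Reasoning
    elsewhere : ∀ {x} → x ∈ concat (map cycle es) → x ∉ cycle e
    elsewhere x∈es x∈e
      with _ , x∈z , z∈ ← ∈-concat⁻′ (map cycle es) x∈es
      with _ , y∈es , refl ← ∈-map⁻ cycle z∈ = All.lookup disj y∈es (x∈e , x∈z)

-- Graphs and their weights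

pair-swap : ∀ {a b : Fin n} .(a≢b : a ≢ b) .(b≢a : b ≢ a) → pair a b a≢b ≡ pair b a b≢a
pair-swap {a = a} {b} a≢b b≢a with Fin.<-cmp a b | Fin.<-cmp b a
... | tri< _ _ _       | tri> _ _ _       = refl
... | tri> _ _ _       | tri< _ _ _       = refl
... | tri≈ _ a≡b _     | _                = contradiction-irr a≢b (λ a≢b → a≢b a≡b)
... | _                | tri≈ _ b≡a _     = contradiction-irr b≢a (λ b≢a → b≢a b≡a)
... | tri< a<b _ _     | tri< _ _ a≮b     = contradiction a<b a≮b
... | tri> a≮b _ _     | tri> _ _ a<b     = contradiction a<b a≮b

pair-< : ∀ {i j : Fin n} .(i≢j : i ≢ j) .(i<j : i Fin.< j) → pair i j i≢j ≡ ((i , j) , [ i<j ])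
pair-< {i = i} {j} i≢j i<j with Fin.<-cmp i j
... | tri< _ _ _   = refl
... | tri≈ i≮j _ _ = contradiction-irr i<j i≮j
... | tri> i≮j _ _ = contradiction-irr i<j i≮j

-- `_′_` acts on the ordered representative, which `pair` may have obtained by swapping; this makes
-- the action independent of that order.
′-pair : ∀ (β : Permutation′ n) {a b} .(a≢b : a ≢ b) .(βa≢βb : β ⟨$⟩ʳ a ≢ β ⟨$⟩ʳ b) →
         β ′ pair a b a≢b ≡ pair (β ⟨$⟩ʳ a) (β ⟨$⟩ʳ b) βa≢βb
′-pair β {a} {b} a≢b βa≢βb with Fin.<-cmp a b
... | tri< _ _ _   = refl
... | tri≈ _ a≡b _ = contradiction-irr a≢b (λ a≢b → a≢b a≡b)
... | tri> _ _ _   = pair-swap {a = β ⟨$⟩ʳ b} {β ⟨$⟩ʳ a} _ _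

′-flip : ∀ (α : Permutation′ n) e → flip α ′ (α ′ e) ≡ e
′-flip α e@((i , j) , [ i<j ]) = begin
  flip α ′ (α ′ e)
    ≡⟨ ′-pair (flip α) _ (λ eq → Fin.<⇒≢ i<j (trans (sym (inverseˡ α)) (trans eq (inverseˡ α)))) ⟩
  pair (flip α ⟨$⟩ʳ (α ⟨$⟩ʳ i)) (flip α ⟨$⟩ʳ (α ⟨$⟩ʳ j)) _
    ≡⟨ pair-cong _ (Fin.<⇒≢ i<j) (inverseˡ α) (inverseˡ α) ⟩
  pair i j _
    ≡⟨ pair-< _ i<j ⟩
  e                 ∎
  where
  open ≡-Reasoning

′-injective : ∀ (α : Permutation′ n) {e e′} → α ′ e ≡ α ′ e′ → e ≡ e′
′-injective α {e} {e′} eq = trans (sym (′-flip α e)) (trans (cong (flip α ′_) eq) (′-flip α e′))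

indexOf : Pair n → Fin (Finite.card (finite-Pair n))
indexOf {n} = Inverse.from (Finite.enum (finite-Pair n))

pairAt-indexOf : (e : Pair n) → pairAt (indexOf e) ≡ e
pairAt-indexOf {n} = Inverse.strictlyInverseˡ (Finite.enum (finite-Pair n))

indexOf-pairAt : ∀ k → indexOf (pairAt {n} k) ≡ k
indexOf-pairAt {n} = Inverse.strictlyInverseʳ (Finite.enum (finite-Pair n))

χ : Graph n → Pair n → Bool
χ G e = lookup (Graph.E G) (indexOf e)

fromχ : (Pair n → Bool) → Graph n
fromχ g = graph (tabulate (g ∘ pairAt))

χ-fromχ : ∀ g (e : Pair n) → χ (fromχ g) e ≡ g e
χ-fromχ g e = trans (Vec.lookup∘tabulate (g ∘ pairAt) (indexOf e)) (cong g (pairAt-indexOf e))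

χ-injective : {G H : Graph n} → (∀ e → χ G e ≡ χ H e) → G ≡ H
χ-injective {n} {graph E₁} {graph E₂} eq = cong graph (begin
  E₁                    ≡⟨ Vec.tabulate∘lookup E₁ ⟨
  tabulate (lookup E₁)  ≡⟨ Vec.tabulate-cong (λ k →
    subst (λ l → lookup E₁ l ≡ lookup E₂ l) (indexOf-pairAt {n} k) (eq (pairAt k))) ⟩
  tabulate (lookup E₂)  ≡⟨ Vec.tabulate∘lookup E₂ ⟩
  E₂                    ∎)
  where open ≡-Reasoning

χ-complement : ∀ G (e : Pair n) → χ (complement G) e ≡ not (χ G e)
χ-complement G e = Vec.lookup-map (indexOf e) not (Graph.E G)

-- Since α′ is injective, only `e` itself can witness that `α ′ e` is an edge of the image.
χ-· : ∀ (α : Permutation′ n) G e → χ (α · G) (α ′ e) ≡ χ G e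
χ-· {n} α G e = trans (Vec.lookup∘tabulate (does ∘ inImage? α G) (indexOf (α ′ e)))
  (image (χ G e) refl)
  where
  image : ∀ b → χ G e ≡ b → does (inImage? α G (indexOf (α ′ e))) ≡ b
  image true  e∈G = dec-true (inImage? α G _)
    (indexOf e , Vec.lookup⇒[]= _ _ e∈G ,
     trans (cong (α ′_) (pairAt-indexOf e)) (sym (pairAt-indexOf (α ′ e))))
  image false e∉G = dec-false (inImage? α G _) λ (l , l∈G , eq) →
    contradiction (trans (sym (Vec.[]=⇒lookup l∈G))
                         (trans (cong (lookup (Graph.E G)) (index≡ eq)) e∉G)) λ ()
    where
    index≡ : ∀ {l} → α ′ pairAt l ≡ pairAt (indexOf (α ′ e)) → l ≡ indexOf e
    index≡ {l} eq = trans (sym (indexOf-pairAt {n} l))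
      (cong indexOf (′-injective α {pairAt l} {e} (trans eq (pairAt-indexOf (α ′ e)))))

weight : Graph n → ℕ
weight {n} G = subsetSum w (χ G) (Finite.elements (finite-Pair n))

-- The weight is a binary number whose digits, at the distinct positions `log₂w`, are the values of
-- the indicator.
weight-injective : {G H : Graph n} → weight G ≡ weight H → G ≡ H
weight-injective {n} {G} {H} eq = χ-injective λ e →
  All.lookup (subsetSum-injective log₂w log₂w-injective (χ G) (χ H)
                                  (elements-unique (finite-Pair n)) eq)
             (∈-elements (finite-Pair n) e)

-- Exponents of `U[ α ]` as weights of graphs

module _ (α : Permutation′ n) where

  open Cycles (finite-Pair n) _≟ₚ_ (α ′_) (′-injective α)
  open Alternation (finite-Pair n) _≟ₚ_ (α ′_) (′-injective α) w

  χ-alternates : ∀ {G} → α · G ≡ complement G → Alternates (χ G)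
  χ-alternates {G} αG≡Ḡ e = begin
    χ G (α ′ e)                     ≡⟨ Bool.not-involutive _ ⟨
    not (not (χ G (α ′ e)))         ≡⟨ cong not (χ-complement G (α ′ e)) ⟨
    not (χ (complement G) (α ′ e))  ≡⟨ cong (λ H → not (χ H (α ′ e))) αG≡Ḡ ⟨
    not (χ (α · G) (α ′ e))         ≡⟨ cong not (χ-· α G e) ⟩
    not (χ G e)                     ∎
    where open ≡-Reasoning

  -- Every pair is an image under α′, so it suffices to compare the two graphs at pairs `α ′ e`.
  alternates⇒·≡complement : ∀ {G} → Alternates (χ G) → α · G ≡ complement G
  alternates⇒·≡complement {G} alt = χ-injective λ y → at (f-surjective y)
    where
    at : ∀ {y} → (∃ λ e → α ′ e ≡ y) → χ (α · G) y ≡ χ (complement G) y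
    at (e , refl) = begin
      χ (α · G) (α ′ e)         ≡⟨ χ-· α G e ⟩
      χ G e                     ≡⟨ Bool.not-involutive _ ⟨
      not (not (χ G e))         ≡⟨ cong not (alt e) ⟨
      not (χ G (α ′ e))         ≡⟨ χ-complement G (α ′ e) ⟨
      χ (complement G) (α ′ e)  ∎
      where open ≡-Reasoning

  U[]≡∏ : U[ α ] ≡ ∏ (map factor (cycles w w-injective))
  U[]≡∏ = refl

  sum-cycles≡sum-elements : ∀ g → subsetSum w g (concat (cycles w w-injective)) ≡
                                  subsetSum w g (Finite.elements (finite-Pair n))
  sum-cycles≡sum-elements g = subsetSum-↭ w g (concat-cycles↭elements w w-injective)

  U[]-occurs⁺ : ∀ {G} → α · G ≡ complement G → weight G occursIn U[ α ]
  U[]-occurs⁺ {G} αG≡Ḡ = subst₂ _occursIn_ (sum-cycles≡sum-elements (χ G)) (sym U[]≡∏)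
    (product-occurs⁺ {χ G} (χ-alternates {G} αG≡Ḡ) (tops w w-injective))

  -- Membership in `A-𝒮` supplies one alternating indicator, from which the one with the required
  -- sum is built cycle by cycle.
  U[]-occurs⁻ : A-𝒮 α → ∀ {L} → L occursIn U[ α ] → ∃ λ G → α · G ≡ complement G × weight G ≡ L
  U[]-occurs⁻ (G₀ , _ , αG₀≡Ḡ₀) {L} occurs
    with g , alt , L≡ ← product-occurs⁻ {χ G₀} (χ-alternates {G₀} αG₀≡Ḡ₀) {tops w w-injective} {L}
                          (tops-disjoint w w-injective) (subst (L occursIn_) U[]≡∏ occurs) =
    fromχ g , alternates⇒·≡complement {fromχ g} χ-alt , weight≡L
    where
    χ-alt : Alternates (χ (fromχ g))
    χ-alt e = trans (χ-fromχ g (α ′ e)) (trans (alt e) (cong not (sym (χ-fromχ g e))))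
    weight≡L : weight (fromχ g) ≡ L
    weight≡L = trans
      (subsetSum-cong w {χ (fromχ g)} {g} {Finite.elements (finite-Pair n)} (All.tabulate λ {e} _ → χ-fromχ g e))
      (trans (sym (sum-cycles≡sum-elements g)) (sym L≡))

-- The bijection between self-complementary graphs and exponents

U-occurs⁺ : (G : Graph n) → SelfComplementary G → weight G occursIn U n
U-occurs⁺ {n} G (α , αG≡Ḡ) =
  -- `permutations` is complete only up to pointwise equality, so α is replaced by its listed
  -- representative; `G` itself shows that `β` passes the filter.
  let β , β∈ , α≈β = find (permutations-complete α)
      βG≡Ḡ = trans (sym (·-cong {α = α} {β} α≈β G)) αG≡Ḡ
  in occursIn-∑⁺ U[_] (∈-filter⁺ A-𝒮? β∈ (G , (β , βG≡Ḡ) , βG≡Ḡ)) {weight G} (U[]-occurs⁺ β {G} βG≡Ḡ)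

U-occurs⁻ : ∀ L → L occursIn U n → ∃ λ (G : Graph n) → SelfComplementary G × weight G ≡ L
U-occurs⁻ {n} L occurs =
  let α , α∈ , in-Uα  = occursIn-∑⁻ U[_] (filter A-𝒮? (permutations n)) {L} occurs
      G , αG≡Ḡ , wt≡L = U[]-occurs⁻ α (proj₂ (∈-filter⁻ A-𝒮? {xs = permutations n} α∈)) {L} in-Uα
  in G , (α , αG≡Ḡ) , wt≡L

-- The inverse picks some graph of the given weight; injectivity of `weight` makes this the original
-- graph.
𝒮↔ℒ𝒮 : ∀ n → 𝒮 n ↔ ℒ𝒮 n
𝒮↔ℒ𝒮 n = mk↔ₛ′
  (Refinement.map weight (λ {G} → U-occurs⁺ G))
  (λ (L , [ occurs ]) → proj₁ (graphOf L occurs) , [ proj₁ (proj₂ (graphOf L occurs)) ])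
  (λ (L , [ occurs ]) → value-injective (proj₂ (proj₂ (graphOf L occurs))))
  (λ (G , [ sc ]) → value-injective
    (weight-injective (proj₂ (proj₂ (graphOf (weight G) (U-occurs⁺ G sc))))))
  where
  graphOf : ∀ L → .(L occursIn U n) → ∃ λ (G : Graph n) → SelfComplementary G × weight G ≡ L
  -- The proof of occurrence is irrelevant, but as a negation it can be recomputed.
  graphOf L occurs = U-occurs⁻ L (¬-recompute occurs)

card-cong : {A B : Set} (finA : Finite A) (finB : Finite B) → A ↔ B → Finite.card finA ≡ Finite.card finB
card-cong finA finB A↔B = ↔⇒≡ (↔-sym (Finite.enum finB) ↔-∘ (A↔B ↔-∘ Finite.enum finA))

theorem9 : ∀ (n : ℕ) → 4 ≤ n → (n % 4 ≡ 0) ⊎ (n % 4 ≡ 1) → lsc n ≡ ∣ℒ𝒮∣ n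
theorem9 n _ _ = card-cong (finite-𝒮 n) (finite-Exponents (U n)) (𝒮↔ℒ𝒮 n)
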